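{- Let $G$ be a connected bipartite graph, $v\in V(G)$, and let $c_0$ be the mill-pond configuration $MP(v)$, i.e. $c_0(v)=1$ and $c_0(x)=0$ for all $x\neq v$. Then for every $t\geq0$, $c_t(v)=1$ if $t$ is even and $c_t(v)=1-\deg(v)$ if $t$ is odd. Moreover, for $i\in\{1,2,\ldots,\epsilon(v)\}$ and $x\in N_i(v)$, \[c_t(x)=\begin{cases}0 & t<i,\\ \deg^+(x) & t\geq i \text{ and } t-i\equiv 0 \pmod 2,\\ -\deg^-(x) & t\geq i \text{ and } t-i\equiv 1\pmod 2.\end{cases}\]
   Context: Diffusion process: for a finite simple graph $G$ and a chip configuration $c_t:V(G)\to\mathbb{Z}$ (negative values allowed), the next configuration is defined simultaneously for every vertex $u$ by $c_{t+1}(u)=c_t(u)-|\{w\in N(u): c_t(u)>c_t(w)\}|+|\{w\in N(u): c_t(u)<c_t(w)\}|$. $\epsilon(v)=\max_{w\in V(G)} d(v,w)$ is the eccentricity of $v$. For $i\geq0$, $N_i(v)$ is the set of vertices at distance exactly $i$ from $v$ (so $N_0(v)=\{v\}$). For $x\in N_i(v)$ with $i\geq1$, $\deg^+(x)=|N(x)\cap N_{i-1}(v)|$; for $x\in N_i(v)$ with $i\geq0$, $\deg^-(x)=|N(x)\cap N_{i+1}(v)|$. -}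

module Defs where

open import Data.Bool using (Bool; if_then_else_)
open import Data.Fin using (Fin; _≟_)
open import Data.Fin.Properties using (any?)
open import Data.Fin.Subset using (Subset; _∩_; ∣_∣)
open import Data.Integer using (ℤ; +_; _+_; _-_; 0ℤ; 1ℤ)
open import Data.Integer.Properties using (_<?_)
open import Data.List using (map; allFin)
open import Data.List.Extrema.Nat using (max)
open import Data.Nat using (ℕ; zero; suc; pred; _≤_; z≤n; s≤s)
import Data.Nat.Properties as ℕ
open import Data.Product using (∃-syntax; Σ-syntax; _×_; _,_; proj₁)
open import Data.Vec using (tabulate)
open import Level using (Level; 0ℓ)
open import Relation.Binary using (Rel; Symmetric; Irreflexive)
  renaming (Decidable to Decidable₂)
open import Relation.Binary.PropositionalEquality using (_≡_; _≢_; refl)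
open import Relation.Nullary using (Dec; yes; no; does; contradiction)
open import Relation.Nullary.Decidable using (map′; _×-dec_)
open import Relation.Unary using (Pred; Decidable)

private
  variable
    ℓ : Level
    n : ℕ

⟦_⟧ : {P : Pred (Fin n) ℓ} → Decidable P → Subset n
⟦ P? ⟧ = tabulate (λ x → does (P? x))

least : {P : Pred ℕ ℓ} → Decidable P → ∀ m → P m →
        ∃[ k ] P k × (∀ j → P j → k ≤ j)
least P? zero    p = zero , p , λ _ _ → z≤n
least P? (suc m) p with P? zero
... | yes p₀ = zero , p₀ , λ _ _ → z≤n
... | no ¬p₀ with least (λ k → P? (suc k)) m p
...   | k , pk , min = suc k , pk , λ where
        zero    p₀ → contradiction p₀ ¬p₀
        (suc j) pj → s≤s (min j pj)

-- A finite simple graph with vertex set Fin n.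
record Graph (n : ℕ) : Set₁ where
  field
    Adj    : Rel (Fin n) 0ℓ
    adj?   : Decidable₂ Adj
    sym    : Symmetric Adj
    irrefl : Irreflexive _≡_ Adj

module _ (G : Graph n) where
  open Graph G

  N : Fin n → Subset n
  N u = ⟦ adj? u ⟧

  deg : Fin n → ℕ
  deg u = ∣ N u ∣

  data Walk : ℕ → Fin n → Fin n → Set where
    []  : ∀ {u} → Walk zero u u
    _∷_ : ∀ {k u z w} → Adj u z → Walk k z w → Walk (suc k) u w

  walk? : ∀ k u w → Dec (Walk k u w)
  walk? zero    u w = map′ (λ { refl → [] }) (λ { [] → refl }) (u ≟ w)
  walk? (suc k) u w =
    map′ (λ { (_ , a , p) → a ∷ p }) (λ { (a ∷ p) → _ , a , p })
         (any? λ z → adj? u z ×-dec walk? k z w)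

  Connected : Set
  Connected = ∀ u w → ∃[ k ] Walk k u w

  Bipartite : Set
  Bipartite = Σ[ side ∈ (Fin n → Bool) ] (∀ {u w} → Adj u w → side u ≢ side w)

  step : (Fin n → ℤ) → (Fin n → ℤ)
  step c u = c u - + ∣ N u ∩ ⟦ (λ w → c w <? c u) ⟧ ∣
                 + + ∣ N u ∩ ⟦ (λ w → c u <? c w) ⟧ ∣

  diffuse : (Fin n → ℤ) → ℕ → (Fin n → ℤ)
  diffuse c₀ zero    = c₀
  diffuse c₀ (suc t) = step (diffuse c₀ t)

  module _ (conn : Connected) where

    -- The least length of a walk, which is also the least length of a path.
    d : Fin n → Fin n → ℕ
    d u w = let (m , p) = conn u w in proj₁ (least (λ k → walk? k u w) m p)

    ε : Fin n → ℕ
    ε v = max 0 (map (d v) (allFin n))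

    Nᵢ : ℕ → Fin n → Subset n
    Nᵢ i v = ⟦ (λ w → d v w ℕ.≟ i) ⟧

    -- deg⁺ is only meaningful for x ≢ v; deg⁺ v v is 0.
    deg⁺ : Fin n → Fin n → ℕ
    deg⁺ v x = ∣ N x ∩ Nᵢ (pred (d v x)) v ∣

    deg⁻ : Fin n → Fin n → ℕ
    deg⁻ v x = ∣ N x ∩ Nᵢ (suc (d v x)) v ∣

MP : Fin n → Fin n → ℤ
MP v x = if does (x ≟ v) then 1ℤ else 0ℤ

{-# OPTIONS --safe #-}

-- At time t a vertex at distance i from v is idle while t < i and is afterwards
-- alternately hot (at t = i, i + 2, …) and cold. Hot vertices carry a positive
-- value, idle and cold ones with a neighbour a value ≤ 0. Since G is bipartite,
-- every edge joins consecutive distance classes, so a hot vertex gives a chip to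
-- all its neighbours, a cold one receives a chip from all its neighbours, and an
-- idle one receives exactly one chip from each neighbour closer to v when the
-- wave reaches it. With deg = deg⁺ + deg⁻ this is consistent with the values
-- MP v + deg⁺ (hot) and MP v - deg⁻ (cold), which cover x = v as well because
-- deg⁺ v v = 0 and deg⁻ v v = deg v.
module Submission where

open import Defs
open import Data.Bool.Properties using (¬-not)
open import Data.Bool using (not; if_then_else_)
open import Data.Fin using (Fin; _≟_)
open import Data.Fin.Subset using (Subset; Empty; inside; outside; _∈_; _⊆_; _∩_; ∁; ∣_∣)
open import Data.Fin.Subset.Properties
  using (⊆-antisym; x∈p∩q⁺; x∈p∩q⁻; Empty-unique; ∣⊥∣≡0; p∩q⊆p; x∉p⇒x∈∁p; x∈∁p⇒x∉p)
open import Data.Integer using (ℤ; +_; -_; _+_; _-_; 0ℤ; 1ℤ; +≤+; +<+)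
import Data.Integer as ℤ
import Data.Integer.Properties as ℤ
open import Data.Integer.Tactic.RingSolver using (solve-∀)
open import Data.Nat using (ℕ; zero; suc; pred; _≤_; _<_; _∸_; _%_; z≤n; s≤s; s≤s⁻¹)
import Data.Nat as ℕ
import Data.Nat.Properties as ℕ
open import Data.Product using (∃-syntax; _×_; _,_; proj₁; proj₂)
open import Data.Sum using (_⊎_; inj₁; inj₂)
open import Data.Vec using ([]; _∷_; there)
open import Data.Vec.Properties using (lookup∘tabulate; lookup⇒[]=; []=⇒lookup)
open import Function using (_∘_)
open import Level using (Level)
open import Relation.Binary.Definitions using (tri<; tri≈; tri>)
open import Relation.Binary.PropositionalEquality
  using (_≡_; _≢_; refl; sym; trans; cong; cong₂; subst; subst₂; ≢-sym)
open import Relation.Nullary using (¬_; Dec; yes; no; does; contradiction)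
open import Relation.Nullary.Decidable using (dec-true; dec-false)
open import Relation.Unary using (Pred; Decidable)

private
  variable
    ℓ : Level
    n : ℕ

-- Finite subsets and the initial configuration

∈⟦⟧⁺ : {P : Pred (Fin n) ℓ} (P? : Decidable P) → ∀ {x} → P x → x ∈ ⟦ P? ⟧
∈⟦⟧⁺ P? {x} px =
  lookup⇒[]= x _ (trans (lookup∘tabulate (does ∘ P?) x) (dec-true (P? x) px))

∈⟦⟧⁻ : {P : Pred (Fin n) ℓ} (P? : Decidable P) → ∀ {x} → x ∈ ⟦ P? ⟧ → P x
∈⟦⟧⁻ P? {x} x∈ with P? x | trans (sym (lookup∘tabulate (does ∘ P?) x)) ([]=⇒lookup x∈)
... | yes px | _  = px
... | no  _  | ()

Empty⇒∣p∣≡0 : {p : Subset n} → Empty p → ∣ p ∣ ≡ 0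
Empty⇒∣p∣≡0 {n} e = trans (cong ∣_∣ (Empty-unique e)) (∣⊥∣≡0 n)

x∈p⇒1≤∣p∣ : {p : Subset n} {x : Fin n} → x ∈ p → 1 ≤ ∣ p ∣
x∈p⇒1≤∣p∣ {p = inside  ∷ _} _                  = s≤s z≤n
x∈p⇒1≤∣p∣ {p = outside ∷ _} (there x∈p) = x∈p⇒1≤∣p∣ x∈p

∣p∣≡∣p∩q∣+∣p∩∁q∣ : (p q : Subset n) → ∣ p ∣ ≡ ∣ p ∩ q ∣ ℕ.+ ∣ p ∩ ∁ q ∣
∣p∣≡∣p∩q∣+∣p∩∁q∣ []            []            = refl
∣p∣≡∣p∩q∣+∣p∩∁q∣ (outside ∷ p) (_       ∷ q) = ∣p∣≡∣p∩q∣+∣p∩∁q∣ p q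
∣p∣≡∣p∩q∣+∣p∩∁q∣ (inside  ∷ p) (inside  ∷ q) = cong suc (∣p∣≡∣p∩q∣+∣p∩∁q∣ p q)
∣p∣≡∣p∩q∣+∣p∩∁q∣ (inside  ∷ p) (outside ∷ q) =
  trans (cong suc (∣p∣≡∣p∩q∣+∣p∩∁q∣ p q)) (sym (ℕ.+-suc _ _))

∩-cong-within : {p q r : Subset n} →
                (∀ {x} → x ∈ p → x ∈ q → x ∈ r) → (∀ {x} → x ∈ p → x ∈ r → x ∈ q) →
                p ∩ q ≡ p ∩ r
∩-cong-within {p = p} {q} {r} q⇒r r⇒q = ⊆-antisym (within q⇒r) (within r⇒q)
  where
  within : ∀ {q r} → (∀ {x} → x ∈ p → x ∈ q → x ∈ r) → p ∩ q ⊆ p ∩ r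
  within {q} f x∈ = let x∈p , x∈q = x∈p∩q⁻ p q x∈ in x∈p∩q⁺ (x∈p , f x∈p x∈q)

p⊆q⇒p∩q≡p : {p q : Subset n} → p ⊆ q → p ∩ q ≡ p
p⊆q⇒p∩q≡p {p = p} {q} p⊆q = ⊆-antisym (p∩q⊆p p q) (λ x∈p → x∈p∩q⁺ (x∈p , p⊆q x∈p))

MP-self : (v : Fin n) → MP v v ≡ 1ℤ
MP-self v = cong (if_then 1ℤ else 0ℤ) (dec-true (v ≟ v) refl)

MP-other : {v x : Fin n} → x ≢ v → MP v x ≡ 0ℤ
MP-other {v = v} {x} x≢v = cong (if_then 1ℤ else 0ℤ) (dec-false (x ≟ v) x≢v)

-- Phases of the wave

data Phase : Set where
  idle hot cold : Phase

-- Time and layer are lowered together, following the wave back, until either the time is 0 or layer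
-- 0 is reached, where the phase has period 2.
phase : ℕ → ℕ → Phase
phase zero          zero    = hot
phase zero          (suc i) = idle
phase (suc zero)    zero    = cold
phase (suc (suc t)) zero    = phase t zero
phase (suc t)       (suc i) = phase t i

-- The pairs of phases of adjacent layers, the one closer to v first; as the wave
-- moves one layer per step, also of one layer at consecutive times, later first.
data _⟫_ : Phase → Phase → Set where
  idle⟫idle : idle ⟫ idle
  hot⟫idle  : hot  ⟫ idle
  hot⟫cold  : hot  ⟫ cold
  cold⟫hot  : cold ⟫ hot

phase-suc-0 : ∀ t → phase (suc t) 0 ⟫ phase t 0
phase-suc-0 zero          = cold⟫hot
phase-suc-0 (suc zero)    = hot⟫cold
phase-suc-0 (suc (suc t)) = phase-suc-0 t

-- Holds by computation only after a split on `t`, since the clauses for layer 0 make `phase` look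
-- below the first `suc` of the time.
phase-suc-suc : ∀ t i → phase (suc t) (suc i) ≡ phase t i
phase-suc-suc zero    i = refl
phase-suc-suc (suc t) i = refl

phase-space : ∀ t i → phase t i ⟫ phase t (suc i)
phase-space zero    zero    = hot⟫idle
phase-space zero    (suc i) = idle⟫idle
phase-space (suc t) zero    = subst (phase (suc t) 0 ⟫_) (sym (phase-suc-suc t 0)) (phase-suc-0 t)
phase-space (suc t) (suc i) =
  subst₂ _⟫_ (sym (phase-suc-suc t i)) (sym (phase-suc-suc t (suc i))) (phase-space t i)

-- By `phase-suc-suc`, a step in time at layer `suc i` is a step in space from layer `suc i` to
-- layer `i`.
phase-time : ∀ t i → phase (suc t) i ⟫ phase t i
phase-time t zero    = phase-suc-0 t
phase-time t (suc i) = subst (_⟫ phase t (suc i)) (sym (phase-suc-suc t i)) (phase-space t i)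

phase-0≢idle : ∀ t → phase t 0 ≢ idle
phase-0≢idle (suc (suc t)) = phase-0≢idle t

phase-idle : ∀ {t i} → t < i → phase t i ≡ idle
phase-idle {zero}  {suc i} _   = refl
phase-idle {suc t} {suc i} t<i = trans (phase-suc-suc t i) (phase-idle (s≤s⁻¹ t<i))

phase-hot : ∀ {t i} → i ≤ t → (t ∸ i) % 2 ≡ 0 → phase t i ≡ hot
phase-hot {zero}        {zero}  _   _ = refl
phase-hot {suc (suc t)} {zero}  _   e = phase-hot {t} z≤n e
phase-hot {suc t}       {suc i} i≤t e = trans (phase-suc-suc t i) (phase-hot (s≤s⁻¹ i≤t) e)

phase-cold : ∀ {t i} → i ≤ t → (t ∸ i) % 2 ≡ 1 → phase t i ≡ cold
phase-cold {suc zero}    {zero}  _   _ = refl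
phase-cold {suc (suc t)} {zero}  _   o = phase-cold {t} z≤n o
phase-cold {suc t}       {suc i} i≤t o = trans (phase-suc-suc t i) (phase-cold (s≤s⁻¹ i≤t) o)

-- Walks, neighbourhoods and distance

least-≤ : {P : Pred ℕ ℓ} (P? : Decidable P) (m : ℕ) (p : P m) →
          ∀ {j} → P j → proj₁ (least P? m p) ≤ j
least-≤ P? m p = proj₂ (proj₂ (least P? m p)) _

module _ (G : Graph n) where
  open Graph G using (Adj; adj?; irrefl) renaming (sym to Adj-sym)

  snoc : ∀ {k u z w} → Walk G k u z → Adj z w → Walk G (suc k) u w
  snoc []      a = a ∷ []
  snoc (b ∷ p) a = b ∷ snoc p a

  unsnoc : ∀ {k u w} → Walk G (suc k) u w → ∃[ z ] Walk G k u z × Adj z w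
  unsnoc (a ∷ [])        = _ , [] , a
  unsnoc (a ∷ p@(_ ∷ _)) = let z , q , b = unsnoc p in z , a ∷ q , b

  ∣N∩⟦⟧∣≡deg : ∀ {P : Pred (Fin n) ℓ} (P? : Decidable P) u →
               (∀ {w} → Adj u w → P w) → ∣ N G u ∩ ⟦ P? ⟧ ∣ ≡ deg G u
  ∣N∩⟦⟧∣≡deg P? u all =
    cong ∣_∣ (p⊆q⇒p∩q≡p (λ w∈ → ∈⟦⟧⁺ P? (all (∈⟦⟧⁻ (adj? u) w∈))))

  ∣N∩⟦⟧∣≡0 : ∀ {P : Pred (Fin n) ℓ} (P? : Decidable P) u →
             (∀ {w} → Adj u w → ¬ P w) → ∣ N G u ∩ ⟦ P? ⟧ ∣ ≡ 0
  ∣N∩⟦⟧∣≡0 P? u none = Empty⇒∣p∣≡0 λ (w , w∈) →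
    let w∈N , w∈P = x∈p∩q⁻ (N G u) ⟦ P? ⟧ w∈
    in none (∈⟦⟧⁻ (adj? u) w∈N) (∈⟦⟧⁻ P? w∈P)

  step-≡ : ∀ (c : Fin n → ℤ) {u y} {loss gain : ℕ} → c u ≡ y →
           ∣ N G u ∩ ⟦ (λ w → c w ℤ.<? c u) ⟧ ∣ ≡ loss →
           ∣ N G u ∩ ⟦ (λ w → c u ℤ.<? c w) ⟧ ∣ ≡ gain →
           step G c u ≡ y - + loss + + gain
  step-≡ c cu≡y l g = cong₂ _+_ (cong₂ _-_ cu≡y (cong +_ l)) (cong +_ g)

  -- Every edge flips the side, so walks of equal length flip it equally often. This rules out edges
  -- inside a distance layer.
  same-side : ((side , _) : Bipartite G) → ∀ {k u u′ w w′} →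
              Walk G k u w → Walk G k u′ w′ → side u ≡ side u′ → side w ≡ side w′
  same-side _              []      []      e = e
  same-side B@(_ , proper) (a ∷ p) (b ∷ q) e =
    same-side B p q
      (trans (¬-not (≢-sym (proper a))) (trans (cong not e) (sym (¬-not (≢-sym (proper b))))))

  module _ (conn : Connected G) (v : Fin n) where

    dist : Fin n → ℕ
    dist = d G conn v

    walk-dist : ∀ w → Walk G (dist w) v w
    walk-dist w = let m , p = conn v w in proj₁ (proj₂ (least (λ k → walk? G k v w) m p))

    dist-≤ : ∀ {k w} → Walk G k v w → dist w ≤ k
    dist-≤ {w = w} q = let m , p = conn v w in least-≤ (λ k → walk? G k v w) m p q

    dist-self : dist v ≡ 0
    dist-self = ℕ.n≤0⇒n≡0 (dist-≤ [])

    dist≡0⇒≡v : ∀ {w} → dist w ≡ 0 → w ≡ v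
    dist≡0⇒≡v {w} e with [] ← subst (λ k → Walk G k v w) e (walk-dist w) = refl

    dist-adj : ∀ {x w} → Adj x w → dist w ≤ suc (dist x)
    dist-adj a = dist-≤ (snoc (walk-dist _) a)

    -- The witness is the last vertex before `x` on a shortest walk from `v`.
    closer-neighbour : ∀ {x} → x ≢ v → ∃[ w ] Adj x w × dist w ≡ pred (dist x)
    closer-neighbour {x} x≢v with dist x in e | walk-dist x
    ... | zero  | _ = contradiction (dist≡0⇒≡v e) x≢v
    ... | suc k | p =
      let z , q , a = unsnoc p
      in z , Adj-sym a ,
         -- `x` is at most one step farther than `z`, which bounds `dist z` from below.
         ℕ.≤-antisym (dist-≤ q) (s≤s⁻¹ (subst (_≤ suc (dist z)) e (dist-adj a)))

    private
      layer? : ∀ i → Decidable (λ w → dist w ≡ i)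
      layer? i w = dist w ℕ.≟ i

    -- As `pred 0` is 0, the layer counted here is that of `v` alone, and `v` is not its own
    -- neighbour.
    deg⁺-self : deg⁺ G conn v v ≡ 0
    deg⁺-self = ∣N∩⟦⟧∣≡0 (layer? _) v λ a e →
      irrefl (sym (dist≡0⇒≡v (trans e (cong pred dist-self)))) a

    deg⁺-pos : ∀ {x} → x ≢ v → 1 ≤ deg⁺ G conn v x
    deg⁺-pos {x} x≢v =
      let w , a , e = closer-neighbour x≢v
      in x∈p⇒1≤∣p∣ (x∈p∩q⁺ (∈⟦⟧⁺ (adj? x) a , ∈⟦⟧⁺ (layer? _) e))

    -- Distance layers of a bipartite graph

    module _ (bip : Bipartite G) where

      -- Distances of adjacent vertices differ by at most 1; if they were equal, two walks of equal
      -- length from `v` would put both ends on one side.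
      dist-edge : ∀ {x w} → Adj x w → dist x ≡ suc (dist w) ⊎ dist w ≡ suc (dist x)
      dist-edge {x} {w} a with ℕ.<-cmp (dist x) (dist w)
      ... | tri< l _ _ = inj₂ (ℕ.≤-antisym (dist-adj a) l)
      ... | tri> _ _ g = inj₁ (ℕ.≤-antisym (dist-adj (Adj-sym a)) g)
      ... | tri≈ _ e _ = contradiction
        (same-side bip (walk-dist x) (subst (λ k → Walk G k v w) (sym e) (walk-dist w)) refl)
        (proj₂ bip a)

      -- By `dist-edge`, a neighbour outside the closer layer lies in the farther one.
      deg≡deg⁺+deg⁻ : ∀ x → deg G x ≡ deg⁺ G conn v x ℕ.+ deg⁻ G conn v x
      deg≡deg⁺+deg⁻ x =
        trans (∣p∣≡∣p∩q∣+∣p∩∁q∣ (N G x) closer)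
              (cong (λ s → deg⁺ G conn v x ℕ.+ ∣ s ∣) (∩-cong-within to from))
        where
        closer  = Nᵢ G conn (pred (dist x)) v
        farther = Nᵢ G conn (suc (dist x)) v

        to : ∀ {w} → w ∈ N G x → w ∈ ∁ closer → w ∈ farther
        to w∈N w∈∁ with dist-edge (∈⟦⟧⁻ (adj? x) w∈N)
        ... | inj₁ e = contradiction (∈⟦⟧⁺ (layer? _) (cong pred (sym e))) (x∈∁p⇒x∉p w∈∁)
        ... | inj₂ e = ∈⟦⟧⁺ (layer? _) e

        from : ∀ {w} → w ∈ N G x → w ∈ farther → w ∈ ∁ closer
        from _ w∈far = x∉p⇒x∈∁p λ w∈close → ℕ.<⇒≢ (s≤s ℕ.pred[n]≤n)
          (trans (sym (∈⟦⟧⁻ (layer? _) w∈close)) (∈⟦⟧⁻ (layer? _) w∈far))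

      deg⁻-self : deg⁻ G conn v v ≡ deg G v
      deg⁻-self = sym (trans (deg≡deg⁺+deg⁻ v) (cong (ℕ._+ deg⁻ G conn v v) deg⁺-self))

      -- Values of the phases and their signs

      value : Phase → Fin n → ℤ
      value idle x = 0ℤ
      value hot  x = MP v x + + deg⁺ G conn v x
      value cold x = MP v x - + deg⁻ G conn v x

      hot-self : value hot v ≡ 1ℤ
      hot-self = cong₂ (λ m k → m + + k) (MP-self v) deg⁺-self

      cold-self : value cold v ≡ 1ℤ - + deg G v
      cold-self = cong₂ (λ m k → m - + k) (MP-self v) deg⁻-self

      hot-other : ∀ {x} → x ≢ v → value hot x ≡ + deg⁺ G conn v x
      hot-other {x} x≢v = cong (_+ + deg⁺ G conn v x) (MP-other x≢v)

      cold-other : ∀ {x} → x ≢ v → value cold x ≡ - + deg⁻ G conn v x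
      cold-other {x} x≢v =
        trans (cong (_- + deg⁻ G conn v x) (MP-other x≢v)) (ℤ.+-identityˡ _)

      hot-pos : ∀ x → 0ℤ ℤ.< value hot x
      hot-pos x = by-cases (x ≟ v)
        where
        by-cases : Dec (x ≡ v) → 0ℤ ℤ.< value hot x
        by-cases (yes refl) = subst (0ℤ ℤ.<_) (sym hot-self) (+<+ (s≤s z≤n))
        by-cases (no x≢v)   = subst (0ℤ ℤ.<_) (sym (hot-other x≢v)) (+<+ (deg⁺-pos x≢v))

      -- The edge matters for `cold` at `v`: the value there is `1 - deg v`, and a neighbour makes
      -- the degree at least 1.
      nonhot-≤0 : ∀ {p x w} → p ≢ hot → Adj x w → value p x ℤ.≤ 0ℤ
      nonhot-≤0 {idle}         _     _ = ℤ.≤-refl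
      nonhot-≤0 {hot}          p≢hot _ = contradiction refl p≢hot
      nonhot-≤0 {cold} {x} {w} _     a = by-cases (x ≟ v)
        where
        by-cases : Dec (x ≡ v) → value cold x ℤ.≤ 0ℤ
        by-cases (yes refl) = subst (ℤ._≤ 0ℤ) (sym cold-self)
          (ℤ.i≤j⇒i-j≤0 (+≤+ (x∈p⇒1≤∣p∣ (∈⟦⟧⁺ (adj? v) a))))
        by-cases (no x≢v)   = subst (ℤ._≤ 0ℤ) (sym (cold-other x≢v)) ℤ.neg-≤-pos

      noncold-≥0 : ∀ {p} x → p ≢ cold → 0ℤ ℤ.≤ value p x
      noncold-≥0 {idle} x _      = ℤ.≤-refl
      noncold-≥0 {hot}  x _      = ℤ.<⇒≤ (hot-pos x)
      noncold-≥0 {cold} x p≢cold = contradiction refl p≢cold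

      cooler : ∀ {p x w} → p ≢ hot → Adj x w → ∀ z → value p x ℤ.< value hot z
      cooler p≢hot a z = ℤ.≤-<-trans (nonhot-≤0 p≢hot a) (hot-pos z)

      value-MP : ∀ x → value (phase 0 (dist x)) x ≡ MP v x
      value-MP x with dist x in e
      ... | suc _ = sym (MP-other {v = v} {x} λ { refl → contradiction (trans (sym e) dist-self) λ() })
      ... | zero  with refl ← dist≡0⇒≡v e =
        trans hot-self (sym (MP-self v))

      -- One diffusion step

      module Step (t : ℕ) (c : Fin n → ℤ) (inv : ∀ x → c x ≡ value (phase t (dist x)) x) where

        lower? : ∀ x → Decidable (λ w → c w ℤ.< c x)
        lower? x w = c w ℤ.<? c x

        higher? : ∀ x → Decidable (λ w → c x ℤ.< c w)
        higher? x w = c x ℤ.<? c w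

        ph : Fin n → Phase
        ph x = phase t (dist x)

        edge : ∀ {x w} → Adj x w → ph x ⟫ ph w ⊎ ph w ⟫ ph x
        edge {x} {w} a with dist-edge a
        ... | inj₁ e rewrite e = inj₂ (phase-space t (dist w))
        ... | inj₂ e rewrite e = inj₁ (phase-space t (dist x))

        -- No constructor of `_⟫_` relates `hot` to `hot`.
        hot-next : ∀ {x w} → ph x ≡ hot → Adj x w → ph w ≢ hot
        hot-next px a pw with edge a
        ... | inj₁ r with () ← subst₂ _⟫_ px pw r
        ... | inj₂ r with () ← subst₂ _⟫_ pw px r

        -- In `_⟫_`, `cold` is paired only with `hot`, on either side.
        cold-next : ∀ {x w} → ph x ≡ cold → Adj x w → ph w ≡ hot
        cold-next {x} {w} px a with ph x | ph w | edge a
        cold-next refl a | _ | _ | inj₁ cold⟫hot = refl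
        cold-next refl a | _ | _ | inj₂ hot⟫cold = refl

        <-edge : ∀ {x w} → Adj x w → ph x ≢ hot → ph w ≡ hot → c x ℤ.< c w
        <-edge {x} {w} a px pw rewrite inv x | inv w | pw = cooler px a w

        <-edge⇒hot : ∀ {x w} → ph x ≡ idle → Adj x w → c x ℤ.< c w → ph w ≡ hot
        <-edge⇒hot {x} {w} px a lt rewrite inv x | inv w | px = go (ph w) lt
          where
          go : ∀ p → 0ℤ ℤ.< value p w → p ≡ hot
          go hot  _  = refl
          go idle lt = contradiction lt (ℤ.<-irrefl refl)
          go cold lt = contradiction lt (ℤ.≤⇒≯ (nonhot-≤0 {cold} (λ()) (Adj-sym a)))

        -- All neighbours are lower, so `x` loses `deg⁺ + deg⁻` chips and gains none: the `deg⁺` in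
        -- its hot value cancels.
        from-hot : ∀ x → ph x ≡ hot → step G c x ≡ value cold x
        from-hot x px =
          trans (step-≡ c (trans (inv x) (cong (λ p → value p x) px))
                  (trans (∣N∩⟦⟧∣≡deg (lower? x) x below) (deg≡deg⁺+deg⁻ x))
                  (∣N∩⟦⟧∣≡0 (higher? x) x (λ a → ℤ.<-asym (below a))))
                (arith (MP v x) _ _)
          where
          below : ∀ {w} → Adj x w → c w ℤ.< c x
          below a = <-edge (Adj-sym a) (hot-next px a) px

          arith : ∀ m a b → m + a - (a + b) + 0ℤ ≡ m - b
          arith = solve-∀

        from-cold : ∀ x → ph x ≡ cold → step G c x ≡ value hot x
        from-cold x px =
          trans (step-≡ c (trans (inv x) (cong (λ p → value p x) px))
                  (∣N∩⟦⟧∣≡0 (lower? x) x (λ a → ℤ.<-asym (above a)))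
                  (trans (∣N∩⟦⟧∣≡deg (higher? x) x above) (deg≡deg⁺+deg⁻ x)))
                (arith (MP v x) _ _)
          where
          above : ∀ {w} → Adj x w → c x ℤ.< c w
          above a = <-edge a (λ e → contradiction (trans (sym px) e) λ()) (cold-next px a)

          arith : ∀ m a b → m - b - 0ℤ + (a + b) ≡ m + a
          arith = solve-∀

        module _ {x : Fin n} (px : ph x ≡ idle) where

          idle≢v : x ≢ v
          idle≢v refl = phase-0≢idle t (trans (cong (phase t) (sym dist-self)) px)

          idle-next : ∀ {w} → Adj x w → ph w ≢ cold
          idle-next a pw with edge a
          ... | inj₁ r with () ← subst₂ _⟫_ px pw r
          ... | inj₂ r with () ← subst₂ _⟫_ pw px r

          -- An idle vertex has value 0, and its neighbours are idle or hot, hence nonnegative.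
          idle-≮ : ∀ {w} → Adj x w → ¬ c w ℤ.< c x
          idle-≮ {w} a = ℤ.≤⇒≯ (subst₂ ℤ._≤_ (sym cx≡0) (sym (inv w)) (noncold-≥0 w (idle-next a)))
            where
            cx≡0 = trans (inv x) (cong (λ p → value p x) px)

          -- The wave moves one layer per step, so `x` next takes the phase that its closer
          -- neighbours have now.
          closer-phase : ∀ {w} → dist x ≡ suc (dist w) → ph w ≡ phase (suc t) (dist x)
          closer-phase {w} e =
            trans (sym (phase-suc-suc t (dist w))) (cong (phase (suc t)) (sym e))

          farther-≢hot : ∀ {w} → dist w ≡ suc (dist x) → ph w ≢ hot
          farther-≢hot e pw
            with () ← subst₂ _⟫_ px (trans (cong (phase t) (sym e)) pw) (phase-space t (dist x))

          gain⇒closer : ∀ {w} → Adj x w → c x ℤ.< c w → dist x ≡ suc (dist w)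
          gain⇒closer a lt with dist-edge a
          ... | inj₁ e = e
          ... | inj₂ e = contradiction (<-edge⇒hot px a lt) (farther-≢hot e)

          step-idle : ∀ {gain} → ∣ N G x ∩ ⟦ higher? x ⟧ ∣ ≡ gain →
                      step G c x ≡ + gain
          step-idle = step-≡ c (trans (inv x) (cong (λ p → value p x) px)) (∣N∩⟦⟧∣≡0 (lower? x) x idle-≮)

          -- A chip could come only from a hot closer neighbour, but by `closer-phase` that layer is
          -- still idle.
          idle→idle : phase (suc t) (dist x) ≡ idle → step G c x ≡ value idle x
          idle→idle next = step-idle (∣N∩⟦⟧∣≡0 (higher? x) x λ a lt →
            contradiction
              (trans (sym (<-edge⇒hot px a lt)) (trans (closer-phase (gain⇒closer a lt)) next))
              λ())

          idle→hot : phase (suc t) (dist x) ≡ hot → step G c x ≡ value hot x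
          idle→hot next = trans
            -- The neighbours higher than `x` are exactly those in the closer layer, all of which
            -- are hot, so the gain is `deg⁺`.
            (step-idle (cong ∣_∣ (∩-cong-within
              (λ w∈N w∈ → ∈⟦⟧⁺ (layer? _)
                (cong pred (sym (gain⇒closer (∈⟦⟧⁻ (adj? x) w∈N) (∈⟦⟧⁻ (higher? x) w∈)))))
              (λ w∈N w∈ → ∈⟦⟧⁺ (higher? x)
                (closer⇒gain (∈⟦⟧⁻ (adj? x) w∈N) (∈⟦⟧⁻ (layer? _) w∈))))))
            (sym (hot-other idle≢v))
            where
            closer⇒gain : ∀ {w} → Adj x w → dist w ≡ pred (dist x) → c x ℤ.< c w
            closer⇒gain {w} a e with dist-edge a
            ... | inj₁ e′ = <-edge a (λ h → contradiction (trans (sym px) h) λ())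
                              (trans (closer-phase e′) next)
            ... | inj₂ e′ = contradiction (trans (sym e) e′) (ℕ.<⇒≢ (s≤s ℕ.pred[n]≤n))

        step-value : ∀ x → step G c x ≡ value (phase (suc t) (dist x)) x
        -- Matching on `phase-time` leaves only the four possible transitions of a phase.
        step-value x with ph x in px | phase (suc t) (dist x) in next | phase-time t (dist x)
        ... | _ | _ | idle⟫idle = idle→idle px next
        ... | _ | _ | hot⟫idle  = idle→hot px next
        ... | _ | _ | hot⟫cold  = from-cold x px
        ... | _ | _ | cold⟫hot  = from-hot x px

      -- Induction on time and the closed formula

      diffuse-value : ∀ t x → diffuse G (MP v) t x ≡ value (phase t (dist x)) x
      diffuse-value zero    x = sym (value-MP x)
      diffuse-value (suc t) x = Step.step-value t (diffuse G (MP v) t) (diffuse-value t) x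

      diffuse-in-phase : ∀ {t x i p} → dist x ≡ i → phase t i ≡ p →
                         diffuse G (MP v) t x ≡ value p x
      diffuse-in-phase {t} {x} refl e = trans (diffuse-value t x) (cong (λ p → value p x) e)

theorem20 : ∀ {n : ℕ} (G : Graph n) (conn : Connected G) → Bipartite G →
    ∀ (v : Fin n) →
    let c = diffuse G (MP v) in
    (∀ t → (t % 2 ≡ 0 → c t v ≡ 1ℤ)
    × (t % 2 ≡ 1 → c t v ≡ 1ℤ - + deg G v))
    ×
    (∀ i → 1 ≤ i → i ≤ ε G conn v → ∀ x → x ∈ Nᵢ G conn i v →
    ∀ t → (t < i → c t x ≡ 0ℤ)
    × (i ≤ t → (t ∸ i) % 2 ≡ 0 → c t x ≡ + deg⁺ G conn v x)
    × (i ≤ t → (t ∸ i) % 2 ≡ 1 → c t x ≡ - (+ deg⁻ G conn v x)))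
theorem20 G conn bip v =
  -- `v` is layer 0 and `t ∸ 0` computes to `t`, so the parity of `t` itself decides the phase.
  (λ t →
    (λ even → trans (at t (dist-self G conn v) (phase-hot {t} z≤n even))
                    (hot-self G conn v bip)) ,
    (λ odd → trans (at t (dist-self G conn v) (phase-cold {t} z≤n odd))
                   (cold-self G conn v bip))) ,
  (λ i 1≤i _ x x∈Nᵢ t →
    let dx≡i = ∈⟦⟧⁻ (λ w → d G conn v w ℕ.≟ i) x∈Nᵢ
        x≢v  = λ x≡v → ℕ.<⇒≢ 1≤i
          (trans (sym (dist-self G conn v)) (trans (cong (d G conn v) (sym x≡v)) dx≡i))
    in (λ t<i → at t dx≡i (phase-idle t<i)) ,
       (λ i≤t even → trans (at t dx≡i (phase-hot i≤t even)) (hot-other G conn v bip x≢v)) ,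
       (λ i≤t odd → trans (at t dx≡i (phase-cold i≤t odd)) (cold-other G conn v bip x≢v)))
  where
  at : ∀ t {x i p} → d G conn v x ≡ i → phase t i ≡ p →
       diffuse G (MP v) t x ≡ value G conn v bip p x
  at t = diffuse-in-phase G conn v bip {t}
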